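{- Let $k\geq 2$ be an integer. Then every Class 1 graph with maximum degree at most $k$ has the Vizing property if and only if for every graph $G$ with $\Delta(G)\leq k$ all proper $(\chi'(G)+1)$-edge colorings of $G$ are Kempe equivalent.
   Context: All graphs are finite, without loops and multiple edges. A proper $t$-edge coloring of $G$ is a map $f:E(G)\to\{1,\dots,t\}$ with $f(e)\neq f(e')$ for adjacent edges $e,e'$; a proper $k$-edge coloring with $k\le t$ is also regarded as a proper $t$-edge coloring. $\Delta(G)$ is the maximum degree and $\chi'(G)$ the chromatic index (least $k$ admitting a proper $k$-edge coloring). $G$ is Class 1 if $\chi'(G)=\Delta(G)$ and Class 2 if $\chi'(G)=\Delta(G)+1$. For a proper $t$-edge coloring $f$ and colors $a,b$, $G_f(a,b)$ is the subgraph induced by the edges colored $a$ or $b$; switching the colors $a$ and $b$ on one connected component of $G_f(a,b)$ is called an interchange (Kempe change). Two colorings are Kempe equivalent if one can be obtained from the other by a sequence of interchanges. A Class 1 graph $G$ has the Vizing property if for every $t\geq\Delta(G)+1$, every proper $t$-edge coloring of $G$ can be transformed into a proper $\Delta(G)$-edge coloring of $G$ by a sequence of interchanges. -}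

module Defs where

open import Data.Nat using (ℕ; zero; suc; _≤_; _<_; _⊔_)
open import Data.Fin as Fin using (Fin)
open import Data.Bool using (Bool; true; false; T; if_then_else_)
open import Data.List using (List; map; foldr)
open import Data.Nat.ListAction using (sum)
open import Data.Fin.Base using () renaming (_<_ to _<ᶠ_)
open import Data.List.Base using () renaming (allFin to allFinL)
open import Data.Product using (Σ; ∃; ∃-syntax; _×_; _,_)
open import Data.Sum using (_⊎_)
open import Relation.Nullary using (¬_)
open import Relation.Binary.PropositionalEquality using (_≡_; _≢_)
open import Relation.Binary.Construct.Closure.ReflexiveTransitive using (Star)

record Graph : Set where
  field
    n     : ℕ
    adj   : Fin n → Fin n → Bool
    sym   : ∀ u v → adj u v ≡ adj v u
    irref : ∀ v → adj v v ≡ false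
open Graph public

record Edge (G : Graph) : Set where
  constructor edge
  field
    u v   : Fin (n G)
    u<v   : u <ᶠ v
    isAdj : T (adj G u v)
open Edge public

Adjacent : {G : Graph} → Edge G → Edge G → Set
Adjacent e e' =
  (u e ≢ u e' ⊎ v e ≢ v e') ×
  (u e ≡ u e' ⊎ u e ≡ v e' ⊎ v e ≡ u e' ⊎ v e ≡ v e')

degree : (G : Graph) → Fin (n G) → ℕ
degree G x = sum (map (λ y → if adj G x y then 1 else 0) (allFinL (n G)))

-- Maximum degree Δ(G) (0 for the graph with no vertices).
Δ : Graph → ℕ
Δ G = foldr _⊔_ 0 (map (degree G) (allFinL (n G)))

-- Edge colorings are maps to ℕ; colors are 0,…,t-1 (i.e. {1,…,t} shifted).
Coloring : Graph → Set
Coloring G = Edge G → ℕ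

Proper : (G : Graph) → ℕ → Coloring G → Set
Proper G t f = (∀ e → f e < t) × (∀ e e' → Adjacent e e' → f e ≢ f e')

Colorable : Graph → ℕ → Set
Colorable G t = ∃[ f ] Proper G t f

IsChromaticIndex : Graph → ℕ → Set
IsChromaticIndex G c = Colorable G c × (∀ j → Colorable G j → c ≤ j)

Class1 : Graph → Set
Class1 G = IsChromaticIndex G (Δ G)

InAB : ℕ → ℕ → ℕ → Set
InAB a b x = x ≡ a ⊎ x ≡ b

ABStep : {G : Graph} → Coloring G → ℕ → ℕ → Edge G → Edge G → Set
ABStep f a b e e' = InAB a b (f e) × InAB a b (f e') × Adjacent e e'

swapCol : ℕ → ℕ → ℕ → ℕ → Set
swapCol a b x y = (x ≡ a × y ≡ b) ⊎ (x ≡ b × y ≡ a) ⊎ (¬ InAB a b x × y ≡ x)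

-- g is obtained from f by one interchange of colors a,b (both among the t
-- colors) on the component of G_f(a,b) containing the edge e0.
Interchange : (G : Graph) → ℕ → Coloring G → Coloring G → Set
Interchange G t f g =
  ∃[ a ] ∃[ b ] ∃[ e0 ] (a < t × b < t × InAB a b (f e0) ×
    (∀ e → (Star (ABStep f a b) e0 e → swapCol a b (f e) (g e)) ×
           (¬ Star (ABStep f a b) e0 e → g e ≡ f e)))

-- Kempe equivalence (colorings identified extensionally)
KempeEquiv : (G : Graph) → ℕ → Coloring G → Coloring G → Set
KempeEquiv G t f g = ∃[ h ] (Star (Interchange G t) f h × (∀ e → h e ≡ g e))

VizingProperty : Graph → Set
VizingProperty G = ∀ t → suc (Δ G) ≤ t → ∀ f → Proper G t f →
  ∃[ g ] (Star (Interchange G t) f g × Proper G (Δ G) g)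

MaxDegAtMost : Graph → ℕ → Set
MaxDegAtMost G k = Δ G ≤ k

{-# OPTIONS --safe #-}
module Submission where

-- By Vizing's fan argument, a proper (t+1)-edge colouring with t > Δ can be turned by interchanges into a
-- proper t-edge colouring: an edge e₀ = xy of colour t starts a fan at x, and once some colour is missing both
-- at x and at the far end of the last fan edge, the fan is recoloured edge by edge from its end, which frees a
-- colour for e₀. When the fan closes up instead, swapping a Kempe chain starting at x produces such a colour,
-- since the chain has only one further end.
--
-- Given the Vizing property, two proper (c+1)-edge colourings, c the chromatic index, may thus be assumed to be
-- c-edge colourings f and g. Let M be the last colour class of g. As colour c is unused, the edges of M can be
-- recoloured to c one at a time in both, and what remains are two c-edge colourings of G − M, whose chromatic
-- index is c − 1: induction on c applies.
--
-- Conversely, the fan argument reduces a colouring of a Class 1 graph to Δ+1 colours, and the result is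
-- Kempe equivalent to an optimal colouring by assumption.

open import Defs
open import Data.Bool using (true; false; T; not; _∧_; if_then_else_)
open import Data.Bool.Properties using (T?; T-irrelevant; T-∧)
open import Data.Empty using (⊥-elim)
open import Data.Fin as Fin using (Fin; toℕ; fromℕ<)
open import Data.Fin.Properties as Finₚ using (_≟_; <-cmp; <-asym; <-irrelevant; pigeonhole; toℕ<n; toℕ-fromℕ<; toℕ-injective)
open import Data.List using (List; []; _∷_; map; foldr; length; lookup; filter; allFin; concatMap)
open import Data.List.Membership.Propositional using (_∈_; _∉_; lose; find)
open import Data.List.Membership.Propositional.Properties using (∈-allFin; ∈-concatMap⁺; ∈-filter⁺; ∈-filter⁻; ∈-lookup; ∈-map⁺)
open import Data.List.Properties using (filter-notAll)
open import Data.List.Relation.Unary.All as All using (All; []; _∷_)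
open import Data.List.Relation.Unary.All.Properties using (¬Any⇒All¬) renaming (map⁺ to All-map⁺)
open import Data.List.Relation.Unary.AllPairs using (_∷_)
open import Data.List.Relation.Unary.Any as Any using (Any; here; there; index)
open import Data.List.Relation.Unary.Any.Properties using (lookup-index)
open import Data.List.Relation.Unary.Unique.Propositional using (Unique)
open import Data.List.Relation.Unary.Unique.Propositional.Properties using (allFin⁺; filter⁺)
open import Data.Nat as ℕ using (ℕ; zero; suc; _≤_; _<_; _⊔_; _+_; z≤n; s≤s)
open import Data.Nat.ListAction using (sum)
open import Data.Nat.Properties as ℕₚ using (≤-trans; m≤m⊔n; m≤n⊔m; ⊔-lub)
open import Data.Product using (∃; ∃₂; ∃-syntax; _×_; _,_; proj₁; proj₂)
open import Data.Sum as Sum using (_⊎_; inj₁; inj₂)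
open import Function using (_∘_; id; mk⇔; Equivalence)
open import Relation.Binary using (DecidableEquality; Decidable; tri<; tri≈; tri>)
open import Relation.Binary.Construct.Closure.ReflexiveTransitive as Star using (Star; ε; _◅_; _◅◅_)
open import Relation.Binary.PropositionalEquality as ≡ using (_≡_; _≢_; _≗_; refl; trans; cong; cong₂; subst; subst₂)
open import Relation.Nullary using (¬_; Dec; yes; no; does; contradiction)
open import Relation.Nullary.Decidable using (map′; _×-dec_; _⊎-dec_; ¬?; does-⇔; isYes; isYes≗does; toWitnessFalse; fromWitnessFalse)
open import Relation.Unary using () renaming (Decidable to Decidable₁)

-- Decidability of reachability over a finite carrier, by the Floyd–Warshall recursion.

module _ {A : Set} (R : A → A → Set) where

  Via : List A → A → A → Set
  Via []       x y = x ≡ y ⊎ R x y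
  Via (z ∷ zs) x y = Via zs x y ⊎ (Via zs x z × Via zs z y)

  -- If both paths pass through the head of the list, the way to it on the first path is joined to
  -- the way from it on the second; the detour through `z` is cut out.
  via-trans : ∀ {zs x y z} → z ∈ zs → Via zs x z → Via zs z y → Via zs x y
  via-trans (here refl) p q = inj₂ (Sum.[ id , proj₁ ] p , Sum.[ id , proj₂ ] q)
  via-trans (there i) (inj₁ p)       (inj₁ q)       = inj₁ (via-trans i p q)
  via-trans (there i) (inj₁ p)       (inj₂ (q , r)) = inj₂ (via-trans i p q , r)
  via-trans (there i) (inj₂ (p , q)) (inj₁ r)       = inj₂ (p , via-trans i q r)
  via-trans (there i) (inj₂ (p , q)) (inj₂ (_ , r)) = inj₂ (p , r)

  via⇒star : ∀ zs {x y} → Via zs x y → Star R x y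
  via⇒star []       (inj₁ refl)    = ε
  via⇒star []       (inj₂ r)       = r ◅ ε
  via⇒star (_ ∷ zs) (inj₁ p)       = via⇒star zs p
  via⇒star (_ ∷ zs) (inj₂ (p , q)) = via⇒star zs p ◅◅ via⇒star zs q

  via-step : ∀ zs {x y} → Via [] x y → Via zs x y
  via-step []       p = p
  via-step (_ ∷ zs) p = inj₁ (via-step zs p)

  star⇒via : ∀ {zs} → (∀ x → x ∈ zs) → ∀ {x y} → Star R x y → Via zs x y
  star⇒via all ε       = via-step _ (inj₁ refl)
  star⇒via all (r ◅ s) = via-trans (all _) (via-step _ (inj₂ r)) (star⇒via all s)

  module _ (_≟ᴬ_ : DecidableEquality A) (R? : Decidable R) where

    via? : ∀ zs → Decidable (Via zs)
    via? []       x y = x ≟ᴬ y ⊎-dec R? x y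
    via? (z ∷ zs) x y = via? zs x y ⊎-dec (via? zs x z ×-dec via? zs z y)

    star? : ∀ zs → (∀ x → x ∈ zs) → Decidable (Star R)
    star? zs all x y = map′ (via⇒star zs) (star⇒via all) (via? zs x y)

-- Edges and incidence.

edge-≡ : ∀ {G} {e d : Edge G} → u e ≡ u d → v e ≡ v d → e ≡ d
edge-≡ {e = edge _ _ p s} {edge _ _ q r} refl refl = cong₂ (edge _ _) (<-irrelevant p q) (T-irrelevant s r)

_≟ᵉ_ : ∀ {G} → DecidableEquality (Edge G)
e ≟ᵉ d = map′ (λ (p , q) → edge-≡ p q) (λ e≡d → cong u e≡d , cong v e≡d)
              (u e ≟ u d ×-dec v e ≟ v d)

edgesOf : ∀ G → Fin (n G) → Fin (n G) → List (Edge G)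
edgesOf G x y with x Finₚ.<? y | T? (adj G x y)
... | yes x<y | yes a = edge x y x<y a ∷ []
... | _       | _     = []

edges : ∀ G → List (Edge G)
edges G = concatMap (λ x → concatMap (edgesOf G x) (allFin (n G))) (allFin (n G))

∈-edgesOf : ∀ {G} (e : Edge G) → e ∈ edgesOf G (u e) (v e)
∈-edgesOf {G} e with u e Finₚ.<? v e | T? (adj G (u e) (v e))
... | yes _ | yes _ = here (edge-≡ refl refl)
... | yes _ | no ¬a = contradiction (isAdj e) ¬a
... | no ¬l | _     = contradiction (u<v e) ¬l

∈-edges : ∀ {G} (e : Edge G) → e ∈ edges G
∈-edges {G} e = ∈-concatMap⁺ _ (lose (∈-allFin (u e)) (∈-concatMap⁺ _ (lose (∈-allFin (v e)) (∈-edgesOf e))))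

anyEdge? : ∀ {G} {P : Edge G → Set} → Decidable₁ P → Dec (∃ P)
anyEdge? P? = map′ (λ p → let (e , _ , q) = find p in e , q) (λ (e , p) → lose (∈-edges e) p)
                   (Any.any? P? (edges _))

Inc : ∀ {G} → Fin (n G) → Edge G → Set
Inc x e = x ≡ u e ⊎ x ≡ v e

inc? : ∀ {G} x (e : Edge G) → Dec (Inc x e)
inc? x e = x ≟ u e ⊎-dec x ≟ v e

-- Junk value u e if x is not an endpoint of e.
other : ∀ {G} → Fin (n G) → Edge G → Fin (n G)
other x e with x ≟ u e
... | yes _ = v e
... | no _  = u e

u≢v : ∀ {G} (e : Edge G) → u e ≢ v e
u≢v e p = Finₚ.<-irrefl p (u<v e)

module _ {G : Graph} where

  other-cases : ∀ {x} {e : Edge G} → Inc x e → (x ≡ u e × other x e ≡ v e) ⊎ (x ≡ v e × other x e ≡ u e)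
  other-cases {x} {e} i with x ≟ u e | i
  ... | yes p | _      = inj₁ (p , refl)
  ... | no p  | inj₁ q = contradiction q p
  ... | no p  | inj₂ q = inj₂ (q , refl)

  other-inc : ∀ {x} {e : Edge G} → Inc x e → Inc (other x e) e
  other-inc i with other-cases i
  ... | inj₁ (_ , q) = inj₂ q
  ... | inj₂ (_ , q) = inj₁ q

  other-≢ : ∀ {x} {e : Edge G} → Inc x e → other x e ≢ x
  other-≢ {e = e} i o with other-cases i
  ... | inj₁ (p , q) = u≢v e (trans (≡.sym p) (trans (≡.sym o) q))
  ... | inj₂ (p , q) = u≢v e (trans (≡.sym q) (trans o p))

  inc-other : ∀ {x y} {e : Edge G} → Inc x e → Inc y e → y ≢ x → y ≡ other x e
  inc-other {y = y} i j y≢x with other-cases i | j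
  ... | inj₁ (refl , q) | inj₁ p = contradiction p y≢x
  ... | inj₁ (_ , q)    | inj₂ p = trans p (≡.sym q)
  ... | inj₂ (_ , q)    | inj₁ p = trans p (≡.sym q)
  ... | inj₂ (refl , q) | inj₂ p = contradiction p y≢x

  -- This is where the absence of multiple edges enters. Endpoints are stored in increasing order,
  -- so two edges with the same ends cannot be stored in opposite orientations.
  other-injective : ∀ {x} {e d : Edge G} → Inc x e → Inc x d → other x e ≡ other x d → e ≡ d
  other-injective {x} {e} {d} i j o with other-cases i | other-cases j
  ... | inj₁ (p , q) | inj₁ (r , s) = edge-≡ (trans (≡.sym p) r) (trans (≡.sym q) (trans o s))
  ... | inj₂ (p , q) | inj₂ (r , s) = edge-≡ (trans (≡.sym q) (trans o s)) (trans (≡.sym p) r)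
  ... | inj₁ (refl , q) | inj₂ (refl , s) =
    contradiction (u<v d) (<-asym (subst (x Fin.<_) (trans (≡.sym q) (trans o s)) (u<v e)))
  ... | inj₂ (refl , q) | inj₁ (refl , s) =
    contradiction (u<v d) (<-asym (subst (Fin._< x) (trans (≡.sym q) (trans o s)) (u<v e)))

  edge-between : ∀ {x y} → T (adj G x y) → ∃ λ (e : Edge G) → Inc x e × Inc y e × other x e ≡ y
  edge-between {x} {y} a with <-cmp x y
  ... | tri< l _ _ = e , inj₁ refl , inj₂ refl , ≡.sym (inc-other {e = e} (inj₁ refl) (inj₂ refl) (u≢v e ∘ ≡.sym))
    where e = edge x y l a
  ... | tri≈ _ refl _ = ⊥-elim (subst T (irref G x) a)
  ... | tri> _ _ l = e , inj₂ refl , inj₁ refl , ≡.sym (inc-other {e = e} (inj₂ refl) (inj₁ refl) (u≢v e))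
    where e = edge y x l (subst T (sym G x y) a)

  inc-adj : ∀ {x} {e : Edge G} → Inc x e → T (adj G x (other x e))
  inc-adj {x} {e} i with other-cases i
  ... | inj₁ (refl , q) = subst (T ∘ adj G x) (≡.sym q) (isAdj e)
  ... | inj₂ (refl , q) = subst (T ∘ adj G x) (≡.sym q) (subst T (sym G (u e) x) (isAdj e))

  adjacent-shares : ∀ (e d : Edge G) → Adjacent e d → ∃[ x ] Inc x e × Inc x d
  adjacent-shares _ _ (_ , inj₁ p)               = _ , inj₁ refl , inj₁ p
  adjacent-shares _ _ (_ , inj₂ (inj₁ p))        = _ , inj₁ refl , inj₂ p
  adjacent-shares _ _ (_ , inj₂ (inj₂ (inj₁ p))) = _ , inj₂ refl , inj₁ p
  adjacent-shares _ _ (_ , inj₂ (inj₂ (inj₂ p))) = _ , inj₂ refl , inj₂ p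

  adjacent-≢ : ∀ (e d : Edge G) → Adjacent e d → e ≢ d
  adjacent-≢ _ _ (inj₁ p , _) refl = p refl
  adjacent-≢ _ _ (inj₂ p , _) refl = p refl

  adjacent : ∀ {x} {e d : Edge G} → e ≢ d → Inc x e → Inc x d → Adjacent e d
  adjacent {e = e} {d} e≢d i j = distinct , share e d i j
    where
    distinct : u e ≢ u d ⊎ v e ≢ v d
    distinct with u e ≟ u d
    ... | no p  = inj₁ p
    ... | yes p = inj₂ (e≢d ∘ edge-≡ p)
    share : ∀ {x} (e d : Edge G) → Inc x e → Inc x d → u e ≡ u d ⊎ u e ≡ v d ⊎ v e ≡ u d ⊎ v e ≡ v d
    share _ _ (inj₁ refl) (inj₁ p) = inj₁ p
    share _ _ (inj₁ refl) (inj₂ p) = inj₂ (inj₁ p)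
    share _ _ (inj₂ refl) (inj₁ p) = inj₂ (inj₂ (inj₁ p))
    share _ _ (inj₂ refl) (inj₂ p) = inj₂ (inj₂ (inj₂ p))

  adjacent-sym : ∀ (e d : Edge G) → Adjacent e d → Adjacent d e
  adjacent-sym e d a = let (_ , i , j) = adjacent-shares e d a in adjacent (adjacent-≢ e d a ∘ ≡.sym) j i

  adjacent? : Decidable (Adjacent {G})
  adjacent? e d = (¬? (u e ≟ u d) ⊎-dec ¬? (v e ≟ v d)) ×-dec
    (u e ≟ u d ⊎-dec u e ≟ v d ⊎-dec v e ≟ u d ⊎-dec v e ≟ v d)

  proper-injective : ∀ {t f x} {e d : Edge G} → Proper G t f → Inc x e → Inc x d → f e ≡ f d → e ≡ d
  proper-injective {e = e} {d} P i j p with e ≟ᵉ d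
  ... | yes q = q
  ... | no q  = contradiction p (proj₂ P e d (adjacent q i j))

-- Degrees.

neighbours : ∀ G → Fin (n G) → List (Fin (n G))
neighbours G x = filter (λ y → T? (adj G x y)) (allFin (n G))

degree≡length : ∀ G x → degree G x ≡ length (neighbours G x)
degree≡length G x = go (allFin (n G))
  where
  go : ∀ ys → sum (map (λ y → if adj G x y then 1 else 0) ys) ≡ length (filter (λ y → T? (adj G x y)) ys)
  go []       = refl
  go (y ∷ ys) with adj G x y
  ... | true  = cong suc (go ys)
  ... | false = go ys

lookup-injective : ∀ {A : Set} {xs : List A} → Unique xs → ∀ i j → lookup xs i ≡ lookup xs j → i ≡ j
lookup-injective (_ ∷ _) Fin.zero    Fin.zero    _ = refl
lookup-injective (p ∷ _) Fin.zero    (Fin.suc j) q = contradiction q (All.lookup p (∈-lookup j))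
lookup-injective (p ∷ _) (Fin.suc i) Fin.zero    q = contradiction (≡.sym q) (All.lookup p (∈-lookup i))
lookup-injective (_ ∷ u) (Fin.suc i) (Fin.suc j) q = cong Fin.suc (lookup-injective u i j q)

foldr-⊔-upper : ∀ {xs x} → x ∈ xs → x ≤ foldr _⊔_ 0 xs
foldr-⊔-upper {y ∷ _} (here refl) = m≤m⊔n y _
foldr-⊔-upper {y ∷ _} (there i)   = ≤-trans (foldr-⊔-upper i) (m≤n⊔m y _)

foldr-⊔-lub : ∀ {xs m} → All (_≤ m) xs → foldr _⊔_ 0 xs ≤ m
foldr-⊔-lub []       = z≤n
foldr-⊔-lub (p ∷ ps) = ⊔-lub p (foldr-⊔-lub ps)

degree≤Δ : ∀ G x → degree G x ≤ Δ G
degree≤Δ G x = foldr-⊔-upper {map (degree G) (allFin (n G))} (∈-map⁺ (degree G) (∈-allFin x))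

Δ≤ : ∀ G {m} → (∀ x → degree G x ≤ m) → Δ G ≤ m
Δ≤ G p = foldr-⊔-lub {map (degree G) (allFin (n G))} (All-map⁺ (All.tabulate (λ {x} _ → p x)))

-- With more than `c` neighbours of `x`, the pigeonhole principle gives two edges at `x` of equal
-- colour; by properness they coincide, and so do the two neighbours.
Colorable⇒Δ≤ : ∀ {G c} → Colorable G c → Δ G ≤ c
Colorable⇒Δ≤ {G} {c} (f , P) = Δ≤ G λ x → ℕₚ.≮⇒≥ λ c<deg → clash x (subst (c <_) (degree≡length G x) c<deg)
  where
  clash : ∀ x → ¬ (c < length (neighbours G x))
  clash x c<len = Finₚ.<-irrefl (lookup-injective (filter⁺ _ (allFin⁺ (n G))) i j same) i<j
    where
    at : ∀ i → ∃ λ (e : Edge G) → Inc x e × Inc (lookup (neighbours G x) i) e × other x e ≡ lookup (neighbours G x) i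
    at i = edge-between (proj₂ (∈-filter⁻ (λ y → T? (adj G x y)) {xs = allFin (n G)} (∈-lookup i)))
    colour : Fin (length (neighbours G x)) → Fin c
    colour i = fromℕ< (proj₁ P (proj₁ (at i)))
    hole = pigeonhole c<len colour
    i = proj₁ hole
    j = proj₁ (proj₂ hole)
    i<j = proj₁ (proj₂ (proj₂ hole))
    e≡d : proj₁ (at i) ≡ proj₁ (at j)
    e≡d = proper-injective P (proj₁ (proj₂ (at i))) (proj₁ (proj₂ (at j)))
      (trans (≡.sym (toℕ-fromℕ< _)) (trans (cong toℕ (proj₂ (proj₂ (proj₂ hole)))) (toℕ-fromℕ< _)))
    same : lookup (neighbours G x) i ≡ lookup (neighbours G x) j
    same = trans (≡.sym (proj₂ (proj₂ (proj₂ (at i))))) (trans (cong (other x) e≡d) (proj₂ (proj₂ (proj₂ (at j)))))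

-- Missing colours.

Missing : ∀ {G} → Coloring G → Fin (n G) → ℕ → Set
Missing f x α = ∀ e → Inc x e → f e ≢ α

module _ {G : Graph} where

  present? : ∀ (f : Coloring G) x α → (∃[ e ] Inc x e × f e ≡ α) ⊎ Missing f x α
  present? f x α with anyEdge? (λ e → inc? x e ×-dec f e ℕ.≟ α)
  ... | yes p = inj₁ p
  ... | no ¬p = inj₂ λ e i q → ¬p (e , i , q)

  -- If all `t` colours occurred at `x`, sending each to the far end of an edge bearing it would
  -- inject them into the fewer than `t` neighbours of `x`.
  missing-colour : ∀ {t} (f : Coloring G) x → Δ G < t → ∃[ α ] α < t × Missing f x α
  missing-colour {t} f x Δ<t with Finₚ.any? {n = t} (λ i → missing? (toℕ i))
    where
    missing? : ∀ α → Dec (Missing f x α)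
    missing? α with present? f x α
    ... | inj₁ (e , i , p) = no λ m → m e i p
    ... | inj₂ m           = yes m
  ... | yes (i , m) = toℕ i , toℕ<n i , m
  ... | no ¬m = contradiction i<j (Finₚ.<-irrefl i≡j)
    where
    at : ∀ (i : Fin t) → ∃[ e ] Inc x e × f e ≡ toℕ i
    at i with present? f x (toℕ i)
    ... | inj₁ p = p
    ... | inj₂ m = contradiction (i , m) ¬m
    member : ∀ i → other x (proj₁ (at i)) ∈ neighbours G x
    member i = ∈-filter⁺ _ (∈-allFin _) (inc-adj {e = proj₁ (at i)} (proj₁ (proj₂ (at i))))
    len<t : length (neighbours G x) < t
    len<t = ℕₚ.≤-<-trans (subst (_≤ Δ G) (degree≡length G x) (degree≤Δ G x)) Δ<t
    hole = pigeonhole len<t (index ∘ member)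
    i = proj₁ hole
    j = proj₁ (proj₂ hole)
    i<j = proj₁ (proj₂ (proj₂ hole))
    e≡d : proj₁ (at i) ≡ proj₁ (at j)
    e≡d = other-injective (proj₁ (proj₂ (at i))) (proj₁ (proj₂ (at j)))
      (trans (lookup-index (member i))
        (trans (cong (lookup (neighbours G x)) (proj₂ (proj₂ (proj₂ hole)))) (≡.sym (lookup-index (member j)))))
    i≡j : i ≡ j
    i≡j = toℕ-injective (trans (≡.sym (proj₂ (proj₂ (at i)))) (trans (cong f e≡d) (proj₂ (proj₂ (at j)))))

-- Colour swaps.

inAB? : ∀ a b x → Dec (InAB a b x)
inAB? a b x = x ℕ.≟ a ⊎-dec x ℕ.≟ b

swapCol-sym : ∀ {a b x y} → swapCol a b x y → swapCol a b y x
swapCol-sym (inj₁ (p , q))        = inj₂ (inj₁ (q , p))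
swapCol-sym (inj₂ (inj₁ (p , q))) = inj₁ (q , p)
swapCol-sym {a} {b} (inj₂ (inj₂ (p , q))) = inj₂ (inj₂ (subst (¬_ ∘ InAB a b) (≡.sym q) p , ≡.sym q))

swapCol-inAB : ∀ {a b x y} → swapCol a b x y → InAB a b x → InAB a b y
swapCol-inAB (inj₁ (_ , q))        _ = inj₂ q
swapCol-inAB (inj₂ (inj₁ (_ , q))) _ = inj₁ q
swapCol-inAB (inj₂ (inj₂ (p , _))) i = contradiction i p

swapCol-functional : ∀ {a b x y z} → swapCol a b x y → swapCol a b x z → y ≡ z
swapCol-functional (inj₁ (p , q)) (inj₁ (_ , s))               = trans q (≡.sym s)
swapCol-functional (inj₁ (p , q)) (inj₂ (inj₁ (r , s)))        = trans q (trans (trans (≡.sym r) p) (≡.sym s))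
swapCol-functional (inj₁ (p , q)) (inj₂ (inj₂ (r , s)))        = contradiction (inj₁ p) r
swapCol-functional (inj₂ (inj₁ (p , q))) (inj₁ (r , s))        = trans q (trans (trans (≡.sym r) p) (≡.sym s))
swapCol-functional (inj₂ (inj₁ (p , q))) (inj₂ (inj₁ (_ , s))) = trans q (≡.sym s)
swapCol-functional (inj₂ (inj₁ (p , q))) (inj₂ (inj₂ (r , s))) = contradiction (inj₂ p) r
swapCol-functional (inj₂ (inj₂ (p , q))) (inj₁ (r , s))        = contradiction (inj₁ r) p
swapCol-functional (inj₂ (inj₂ (p , q))) (inj₂ (inj₁ (r , s))) = contradiction (inj₂ r) p
swapCol-functional (inj₂ (inj₂ (p , q))) (inj₂ (inj₂ (r , s))) = trans q (≡.sym s)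

swapCol-injective : ∀ {a b x y z} → swapCol a b x z → swapCol a b y z → x ≡ y
swapCol-injective p q = swapCol-functional (swapCol-sym p) (swapCol-sym q)

swapCol-< : ∀ {a b x y t} → a < t → b < t → x < t → swapCol a b x y → y < t
swapCol-< a<t b<t x<t (inj₁ (_ , refl))        = b<t
swapCol-< a<t b<t x<t (inj₂ (inj₁ (_ , refl))) = a<t
swapCol-< a<t b<t x<t (inj₂ (inj₂ (_ , refl))) = x<t

swapCol-total : ∀ a b x → ∃ (swapCol a b x)
swapCol-total a b x with inAB? a b x
... | yes (inj₁ p) = b , inj₁ (p , refl)
... | yes (inj₂ p) = a , inj₂ (inj₁ (p , refl))
... | no p         = x , inj₂ (inj₂ (p , refl))

-- Interchanges.

module _ {G : Graph} where

  Component : Coloring G → ℕ → ℕ → Edge G → Edge G → Set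
  Component f a b = Star (ABStep f a b)

  component? : ∀ f a b → Decidable (Component f a b)
  component? f a b = star? (ABStep f a b) _≟ᵉ_
    (λ e d → inAB? a b (f e) ×-dec inAB? a b (f d) ×-dec adjacent? e d) (edges G) ∈-edges

  component-inAB : ∀ {f a b e d} → InAB a b (f e) → Component f a b e d → InAB a b (f d)
  component-inAB i ε                 = i
  component-inAB i ((_ , j , _) ◅ s) = component-inAB j s

  component-closed : ∀ {f a b e d d′ x} → InAB a b (f e) → Component f a b e d → Inc x d → Inc x d′ →
    InAB a b (f d′) → Component f a b e d′
  component-closed {d = d} {d′} i s j k l with d ≟ᵉ d′
  ... | yes refl = s
  ... | no d≢d′  = s ◅◅ ((component-inAB i s , l , adjacent d≢d′ j k) ◅ ε)

  component-mono : ∀ {f g a b} → (∀ e → InAB a b (f e) → InAB a b (g e)) → ∀ {e d} →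
    Component f a b e d → Component g a b e d
  component-mono h = Star.map λ (p , q , r) → h _ p , h _ q , r

  Touched : Coloring G → ℕ → ℕ → Edge G → Fin (n G) → Set
  Touched f a b e₀ x = ∃[ e ] Inc x e × Component f a b e₀ e

  touched? : ∀ f a b e₀ x → Dec (Touched f a b e₀ x)
  touched? f a b e₀ x = anyEdge? (λ e → inc? x e ×-dec component? f a b e₀ e)

  -- The last component of Interchange.
  Swapped : ℕ → ℕ → Edge G → Coloring G → Coloring G → Set
  Swapped a b e₀ f g = ∀ e → (Component f a b e₀ e → swapCol a b (f e) (g e)) ×
                             (¬ Component f a b e₀ e → g e ≡ f e)

  swapped-exists : ∀ a b e₀ f → ∃ (Swapped a b e₀ f)
  swapped-exists a b e₀ f = (λ e → proj₁ (at e)) , λ e → proj₂ (at e)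
    where
    at : ∀ e → ∃ λ y → (Component f a b e₀ e → swapCol a b (f e) y) × (¬ Component f a b e₀ e → y ≡ f e)
    at e with component? f a b e₀ e
    ... | yes s = let (y , p) = swapCol-total a b (f e) in y , (λ _ → p) , contradiction s
    ... | no ¬s = f e , (λ s → contradiction s ¬s) , λ _ → refl

  module _ {a b e₀ f g} (i₀ : InAB a b (f e₀)) (S : Swapped a b e₀ f g) where

    swapped-inAB : ∀ e → InAB a b (f e) → InAB a b (g e)
    swapped-inAB e i with component? f a b e₀ e
    ... | yes s = swapCol-inAB (proj₁ (S e) s) i
    ... | no ¬s = subst (InAB a b) (≡.sym (proj₂ (S e) ¬s)) i

    swapped-inAB⁻ : ∀ e → InAB a b (g e) → InAB a b (f e)
    swapped-inAB⁻ e i with component? f a b e₀ e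
    ... | yes s = component-inAB i₀ s
    ... | no ¬s = subst (InAB a b) (proj₂ (S e) ¬s) i

    -- The edges coloured `a` or `b` are the same before and after, so the component is unchanged
    -- and the same swap undoes itself.
    swapped-sym : Swapped a b e₀ g f
    swapped-sym e = swapCol-sym ∘ proj₁ (S e) ∘ component-mono swapped-inAB⁻ ,
                    λ ¬s → ≡.sym (proj₂ (S e) (¬s ∘ component-mono swapped-inAB))

    swapped-proper : ∀ {t} → a < t → b < t → Proper G t f → Proper G t g
    swapped-proper {t} a<t b<t P = bound , proper
      where
      bound : ∀ e → g e < t
      bound e with component? f a b e₀ e
      ... | yes s = swapCol-< a<t b<t (proj₁ P e) (proj₁ (S e) s)
      ... | no ¬s = subst (_< t) (≡.sym (proj₂ (S e) ¬s)) (proj₁ P e)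
      -- A clash across the boundary would give the outer edge a colour in {a, b}; being adjacent to
      -- the component, it would then belong to it.
      cross : ∀ e d → Adjacent e d → Component f a b e₀ e → ¬ Component f a b e₀ d → g e ≢ g d
      cross e d e~d s ¬s p = let (_ , j , k) = adjacent-shares e d e~d in
        ¬s (component-closed i₀ s j k
          (swapped-inAB⁻ d (subst (InAB a b) p (swapped-inAB e (component-inAB i₀ s)))))
      proper : ∀ e d → Adjacent e d → g e ≢ g d
      proper e d e~d p with component? f a b e₀ e | component? f a b e₀ d
      ... | yes s | yes r = proj₂ P e d e~d (swapCol-injective (proj₁ (S e) s)
                              (subst (swapCol a b (f d)) (≡.sym p) (proj₁ (S d) r)))
      ... | yes s | no ¬r = cross e d e~d s ¬r p
      ... | no ¬s | yes r = cross d e (adjacent-sym e d e~d) r ¬s (≡.sym p)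
      ... | no ¬s | no ¬r = proj₂ P e d e~d (trans (≡.sym (proj₂ (S e) ¬s)) (trans p (proj₂ (S d) ¬r)))

    swapped-missing-≢ : ∀ {x c} → ¬ InAB a b c → Missing f x c → Missing g x c
    swapped-missing-≢ c∉ m e i p with component? f a b e₀ e
    ... | yes s = c∉ (subst (InAB a b) p (swapped-inAB e (component-inAB i₀ s)))
    ... | no ¬s = m e i (trans (≡.sym (proj₂ (S e) ¬s)) p)

    swapped-missing-untouched : ∀ {x c} → ¬ Touched f a b e₀ x → Missing f x c → Missing g x c
    swapped-missing-untouched ¬τ m e i p = m e i (trans (≡.sym (proj₂ (S e) λ s → ¬τ (e , i , s))) p)

    -- Once the component reaches `x`, it contains every edge at `x` coloured `a` or `b`, so the
    -- swap acts on the colours missing at `x` as well.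
    swapped-missing-touched : ∀ {x c c′} → Touched f a b e₀ x → InAB a b c → swapCol a b c c′ →
      Missing f x c → Missing g x c′
    swapped-missing-touched {c′ = c′} (d , j , r) c∈ σ m e i p = m e i (swapCol-injective (proj₁ (S e) s)
        (subst (swapCol a b _) (≡.sym p) σ))
      where
      s : Component f a b e₀ e
      s = component-closed i₀ r j i (swapped-inAB⁻ e (subst (InAB a b) (≡.sym p) (swapCol-inAB σ c∈)))

    swapped-fixes : ∀ {e} → ¬ InAB a b (f e) → g e ≡ f e
    swapped-fixes {e} ∉ = proj₂ (S e) (∉ ∘ component-inAB i₀)

  module _ {t : ℕ} where

    interchange-proper : ∀ {f g} → Proper G t f → Interchange G t f g → Proper G t g
    interchange-proper {f} {g} P (a , b , e₀ , a<t , b<t , i₀ , S) = swapped-proper {f = f} {g} i₀ S a<t b<t P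

    interchange-sym : ∀ {f g} → Interchange G t f g → Interchange G t g f
    interchange-sym {f} {g} (a , b , e₀ , a<t , b<t , i₀ , S) =
      a , b , e₀ , a<t , b<t , swapped-inAB {f = f} {g} i₀ S e₀ i₀ , swapped-sym {f = f} {g} i₀ S

    -- A Kempe equivalence reaches its target only pointwise, so composing two of them means
    -- restarting the second at a pointwise equal colouring. Only its first interchange has to be
    -- adapted.
    interchange-≗ : ∀ {f g h} → f ≗ g → Interchange G t g h → Interchange G t f h
    interchange-≗ {f} {g} {h} f≗g (a , b , e₀ , a<t , b<t , i₀ , S) =
      a , b , e₀ , a<t , b<t , from e₀ i₀ , λ e →
        (λ s → subst (λ x → swapCol a b x (h e)) (≡.sym (f≗g e)) (proj₁ (S e) (component-mono to s))) ,
        (λ ¬s → trans (proj₂ (S e) (¬s ∘ component-mono from)) (≡.sym (f≗g e)))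
      where
      to : ∀ e → InAB a b (f e) → InAB a b (g e)
      to e = subst (InAB a b) (f≗g e)
      from : ∀ e → InAB a b (g e) → InAB a b (f e)
      from e = subst (InAB a b) (≡.sym (f≗g e))

    interchanges-proper : ∀ {f g} → Proper G t f → Star (Interchange G t) f g → Proper G t g
    interchanges-proper P ε = P
    interchanges-proper P (_◅_ {f} {g} i s) = interchanges-proper (interchange-proper {f} {g} P i) s

    kempe-star : ∀ {f g} → Star (Interchange G t) f g → KempeEquiv G t f g
    kempe-star s = _ , s , λ _ → refl

    kempe-≗ : ∀ {f g h} → f ≗ g → KempeEquiv G t g h → KempeEquiv G t f h
    kempe-≗ f≗g (_ , ε , p) = _ , ε , λ e → trans (f≗g e) (p e)
    kempe-≗ {f} {g} f≗g (_ , _◅_ {j = k} i s , p) = _ , interchange-≗ {f} {g} {k} f≗g i ◅ s , p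

    kempe-trans : ∀ {f g h} → KempeEquiv G t f g → KempeEquiv G t g h → KempeEquiv G t f h
    kempe-trans (_ , s , p) q = let (_ , s′ , p′) = kempe-≗ p q in _ , s ◅◅ s′ , p′

    kempe-sym : ∀ {f g} → KempeEquiv G t f g → KempeEquiv G t g f
    kempe-sym (_ , s , p) = kempe-≗ (≡.sym ∘ p) (kempe-star (Star.reverse (λ {f} {g} → interchange-sym {f} {g}) s))

  interchange-mono : ∀ {s t f g} → s ≤ t → Interchange G s f g → Interchange G t f g
  interchange-mono s≤t (a , b , e₀ , a<s , b<s , r) =
    a , b , e₀ , ℕₚ.<-≤-trans a<s s≤t , ℕₚ.<-≤-trans b<s s≤t , r

  proper-mono : ∀ {s t f} → s ≤ t → Proper G s f → Proper G t f
  proper-mono s≤t (p , q) = (λ e → ℕₚ.<-≤-trans (p e) s≤t) , q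

  proper-≗ : ∀ {t f g} → f ≗ g → Proper G t f → Proper G t g
  proper-≗ f≗g (p , q) = (λ e → subst (_< _) (f≗g e) (p e)) ,
    λ e d a r → q e d a (trans (f≗g e) (trans r (≡.sym (f≗g d))))

  -- Recolouring a single edge.

  recolour : Coloring G → Edge G → ℕ → Coloring G
  recolour f e α d with d ≟ᵉ e
  ... | yes _ = α
  ... | no _  = f d

  recolour-at : ∀ f e α → recolour f e α e ≡ α
  recolour-at f e α with e ≟ᵉ e
  ... | yes _ = refl
  ... | no p  = contradiction refl p

  recolour-≢ : ∀ f {e d} α → d ≢ e → recolour f e α d ≡ f d
  recolour-≢ f {e} {d} α d≢e with d ≟ᵉ e
  ... | yes p = contradiction p d≢e
  ... | no _  = refl

  -- When α is missing at both ends of e, the component of e in the colours f e and α is e alone.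
  recolour-interchange : ∀ {t f e α} → Proper G t f → α < t → (∀ x → Inc x e → Missing f x α) →
    Interchange G t f (recolour f e α)
  recolour-interchange {t} {f} {e} {α} P α<t m = f e , α , e , proj₁ P e , α<t , inj₁ refl , λ d →
      (λ s → subst (λ d → swapCol (f e) α (f d) (recolour f e α d)) (≡.sym (alone s)) (inj₁ (refl , recolour-at f e α))) ,
      (λ ¬s → recolour-≢ f α λ { refl → ¬s ε })
    where
    alone : ∀ {d} → Component f (f e) α e d → d ≡ e
    alone ε = refl
    alone (_◅_ {j = d} (_ , inj₁ p , a) _) = contradiction (≡.sym p) (proj₂ P e d a)
    alone (_◅_ {j = d} (_ , inj₂ p , a) _) =
      let (x , i , j) = adjacent-shares e d a in contradiction p (m x i d j)

  missing-ends : ∀ {f : Coloring G} {x α} {e : Edge G} → Inc x e → Missing f x α → Missing f (other x e) α →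
    ∀ y → Inc y e → Missing f y α
  missing-ends {f} {x} {α} {e} i m m′ y j with y Fin.≟ x
  ... | yes refl = m
  ... | no y≢x   = subst (λ y → Missing f y α) (≡.sym (inc-other i j y≢x)) m′

  recolour-missing : ∀ {f : Coloring G} {e α x c} → ¬ Inc x e → Missing f x c → Missing (recolour f e α) x c
  recolour-missing {f} {α = α} x∉e m d i p = m d i (trans (≡.sym (recolour-≢ f α λ { refl → x∉e i })) p)

  -- By properness `e` was the only edge at `x` of its old colour, and its new colour, missing at
  -- `x`, differs from the old one.
  recolour-frees : ∀ {t} {f : Coloring G} {e α x} → Proper G t f → Inc x e → Missing f x α →
    Missing (recolour f e α) x (f e)
  recolour-frees {f = f} {e} {α} P i m d j p with d ≟ᵉ e
  ... | yes refl = m d j (≡.sym p)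
  ... | no d≢e   = d≢e (proper-injective P j i p)

-- Kempe chains as paths.

module _ {G : Graph} {t : ℕ} {f : Coloring G} (P : Proper G t f) {α γ : ℕ} where

  -- Two colours allow at most two edges at a vertex. This makes the continuation of a chain past a
  -- vertex unique.
  two-colours : ∀ {x} {e d d′ : Edge G} → Inc x e → Inc x d → Inc x d′ →
    InAB α γ (f e) → InAB α γ (f d) → InAB α γ (f d′) → d ≢ e → d′ ≢ e → d ≡ d′
  two-colours i j k (inj₁ p) (inj₁ q) _        d≢e _ = contradiction (proper-injective P j i (trans q (≡.sym p))) d≢e
  two-colours i j k (inj₂ p) (inj₂ q) _        d≢e _ = contradiction (proper-injective P j i (trans q (≡.sym p))) d≢e
  two-colours i j k (inj₁ p) _        (inj₁ r) _ d′≢e = contradiction (proper-injective P k i (trans r (≡.sym p))) d′≢e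
  two-colours i j k (inj₂ p) _        (inj₂ r) _ d′≢e = contradiction (proper-injective P k i (trans r (≡.sym p))) d′≢e
  two-colours i j k (inj₁ _) (inj₂ q) (inj₂ r) _ _ = proper-injective P j k (trans q (≡.sym r))
  two-colours i j k (inj₂ _) (inj₁ q) (inj₁ r) _ _ = proper-injective P j k (trans q (≡.sym r))

  module _ {x e₀} (x∈e₀ : Inc x e₀) (f-e₀ : f e₀ ≡ α) (x-misses : Missing f x γ) where

    -- Walk m e y: the m-th edge of the chain traversed from x along e₀ is e, and it is entered at the
    -- endpoint other than y.
    data Walk : ℕ → Edge G → Fin (n G) → Set where
      start : Walk zero e₀ (other x e₀)
      step  : ∀ {m e y d} → Walk m e y → Inc y d → d ≢ e → InAB α γ (f d) → Walk (suc m) d (other y d)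

    walk-inc : ∀ {m e y} → Walk m e y → Inc y e
    walk-inc start          = other-inc x∈e₀
    walk-inc (step _ i _ _) = other-inc i

    walk-inAB : ∀ {m e y} → Walk m e y → InAB α γ (f e)
    walk-inAB start          = inj₁ f-e₀
    walk-inAB (step _ _ _ c) = c

    walk-unique : ∀ {m e y d z} → Walk m e y → Walk m d z → e ≡ d × y ≡ z
    walk-unique start start = refl , refl
    walk-unique (step w i p c) (step w′ i′ p′ c′) with walk-unique w w′
    ... | refl , refl with two-colours (walk-inc w) i i′ (walk-inAB w) c c′ p p′
    ... | refl = refl , refl

    -- The edge following position `l` is returned as well: it witnesses that the chain does not end
    -- there.
    walk-prefix : ∀ {l m e y} → l < m → Walk m e y →
      ∃[ e′ ] ∃[ y′ ] ∃[ d ] Walk l e′ y′ × Inc y′ d × d ≢ e′ × InAB α γ (f d)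
    walk-prefix {l} {suc m} (s≤s l≤m) (step {e = e′} {y′} {d} w i p c) with ℕₚ.m≤n⇒m<n∨m≡n l≤m
    ... | inj₁ l<m  = walk-prefix l<m w
    ... | inj₂ refl = e′ , y′ , d , w , i , p , c

    -- An edge meeting `e` at its exit prolongs the walk. One meeting it at its entry is the
    -- preceding edge, by `two-colours`; at `x` there is no such edge, since `e₀` has the colour α
    -- and γ is missing.
    walk-step : ∀ {m e y d} → Walk m e y → ABStep f α γ e d → ∃[ l ] ∃[ z ] Walk l d z
    walk-step {e = e} {y} {d} w (_ , c , e~d) with adjacent-shares e d e~d
    ... | z , i , j with z Fin.≟ y
    ... | yes refl = _ , _ , step w j (adjacent-≢ e d e~d ∘ ≡.sym) c
    ... | no z≢y   = back w (inc-other (walk-inc w) i z≢y)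
      where
      back : ∀ {m y} → Walk m e y → z ≡ other y e → ∃[ l ] ∃[ z ] Walk l d z
      back start refl = Sum.[ (λ p → contradiction (proper-injective P i j (trans f-e₀ (≡.sym p))) (adjacent-≢ e d e~d))
                            , (λ p → contradiction p (x-misses d (subst (λ z → Inc z d) (≡.sym x≡) j))) ] c
        where x≡ = inc-other (other-inc x∈e₀) x∈e₀ (other-≢ x∈e₀ ∘ ≡.sym)
      back (step {y = y′} w′ i′ e≢e′ c′) refl with inc-other (other-inc i′) i′ (other-≢ i′ ∘ ≡.sym)
      ... | y′≡ with two-colours i′ (walk-inc w′) (subst (λ z → Inc z d) (≡.sym y′≡) j) c′ (walk-inAB w′) c
                       (e≢e′ ∘ ≡.sym) (adjacent-≢ e d e~d ∘ ≡.sym)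
      ... | refl = _ , _ , w′

    walk-component : ∀ {m e y d} → Walk m e y → Component f α γ e d → ∃[ l ] ∃[ z ] Walk l d z
    walk-component w ε = _ , _ , w
    walk-component w (r ◅ s) = let (_ , _ , w′) = walk-step w r in walk-component w′ s

    -- The entry of a walk edge is either `x` or lies on two consecutive chain edges, which bear
    -- both α and γ; a vertex other than `x` that misses α must be the exit.
    walk-end : ∀ {m e y z} → Walk m e y → Inc z e → z ≢ x → Missing f z α → z ≡ y
    walk-end {e = e} {y} {z} w i z≢x z-misses with z Fin.≟ y
    ... | yes z≡y = z≡y
    ... | no z≢y  = contradiction (inc-other (walk-inc w) i z≢y) (tail w i)
      where
      tail : ∀ {m e y} → Walk m e y → Inc z e → z ≢ other y e
      tail start i z≡ = z≢x (trans z≡ (≡.sym (inc-other (other-inc x∈e₀) x∈e₀ (other-≢ x∈e₀ ∘ ≡.sym))))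
      tail (step {e = e′} {y′} {d} w′ i′ d≢e′ c) i z≡
        with trans z≡ (≡.sym (inc-other (other-inc i′) i′ (other-≢ i′ ∘ ≡.sym)))
      ... | refl with c | walk-inAB w′
      ... | inj₁ p | _      = z-misses d i p
      ... | inj₂ _ | inj₁ q = z-misses e′ (walk-inc w′) q
      ... | inj₂ p | inj₂ q = d≢e′ (proper-injective P i (walk-inc w′) (trans p (≡.sym q)))

    walk-stops : ∀ {m e y d} → Walk m e y → Inc y d → d ≢ e → InAB α γ (f d) → ¬ Missing f y α
    walk-stops w i d≢e (inj₁ p) y-misses = y-misses _ i p
    walk-stops {e = e} w i d≢e (inj₂ p) y-misses with walk-inAB w
    ... | inj₁ q = y-misses e (walk-inc w) q
    ... | inj₂ q = d≢e (proper-injective P i (walk-inc w) (trans p (≡.sym q)))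

    -- Both vertices are exits of walks along the same chain. If one walk were shorter, the longer
    -- one would continue past its exit, which would then see both α and γ.
    chain-end-unique : ∀ {y z} → y ≢ x → z ≢ x → Missing f y α → Missing f z α →
      Touched f α γ e₀ y → Touched f α γ e₀ z → y ≡ z
    chain-end-unique {y} {z} y≢x z≢x y-misses z-misses (e , i , s) (d , j , r)
      with walk-component start s | walk-component start r
    ... | l , y′ , w | m , z′ , w′ with walk-end w i y≢x y-misses | walk-end w′ j z≢x z-misses
    ... | refl | refl with ℕₚ.<-cmp l m
    ... | tri≈ _ refl _ = proj₂ (walk-unique w w′)
    ... | tri< l<m _ _ with walk-prefix l<m w′
    ... | _ , _ , _ , w″ , k , d≢ , c with walk-unique w w″
    ... | refl , refl = contradiction y-misses (walk-stops w k d≢ c)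
    chain-end-unique {y} {z} y≢x z≢x y-misses z-misses (e , i , s) (d , j , r)
        | l , y′ , w | m , z′ , w′ | refl | refl | tri> _ _ m<l with walk-prefix m<l w
    ... | _ , _ , _ , w″ , k , d≢ , c with walk-unique w′ w″
    ... | refl , refl = contradiction z-misses (walk-stops w′ k d≢ c)

-- Vizing fans.

module _ {G : Graph} {t : ℕ} where

  -- No other edge acquires the colour t, so the edges of colour t can be treated one after another.
  Removes : Edge G → Coloring G → Set
  Removes e₀ f = ∃[ g ] (Star (Interchange G (suc t)) f g × (∀ e → g e ≡ t → f e ≡ t) × g e₀ ≢ t)

  removes-◅ : ∀ {e₀} {f g : Coloring G} → Interchange G (suc t) f g → (∀ e → g e ≡ t → f e ≡ t) → Removes e₀ g → Removes e₀ f
  removes-◅ i h (k , s , h′ , p) = k , i ◅ s , (λ e → h e ∘ h′ e) , p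

  recolour-keeps : ∀ {f : Coloring G} {e α} → α < t → ∀ d → recolour f e α d ≡ t → f d ≡ t
  recolour-keeps {e = e} α<t d p with d ≟ᵉ e
  ... | yes _ = contradiction p (ℕₚ.<⇒≢ α<t)
  ... | no _  = p

  inAB-< : ∀ {a b c} → a < t → b < t → InAB a b c → c < t
  inAB-< a<t b<t (inj₁ refl) = a<t
  inAB-< a<t b<t (inj₂ refl) = b<t

  swapped-keeps : ∀ {a b e₀} {f g : Coloring G} → a < t → b < t → InAB a b (f e₀) → Swapped a b e₀ f g →
    ∀ e → g e ≡ t → f e ≡ t
  swapped-keeps {a} {b} {f = f} {g} a<t b<t i₀ S e p with inAB? a b (f e)
  ... | yes i = contradiction p (ℕₚ.<⇒≢ (inAB-< a<t b<t (swapped-inAB {f = f} {g} i₀ S e i)))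
  ... | no ∉  = trans (≡.sym (swapped-fixes {f = f} {g} i₀ S ∉)) p

  module _ {x : Fin (n G)} {e₀ : Edge G} (x∈e₀ : Inc x e₀) where

    -- Fans are listed last edge first.
    data Fan (f : Coloring G) : List (Edge G) → Set where
      seed : Fan f (e₀ ∷ [])
      grow : ∀ {e d ds} → Fan f (d ∷ ds) → Inc x e → All (e ≢_) (d ∷ ds) → f e < t →
             Missing f (other x d) (f e) → Fan f (e ∷ d ∷ ds)

    fan-inc : ∀ {f ds} → Fan f ds → All (Inc x) ds
    fan-inc seed             = x∈e₀ ∷ []
    fan-inc (grow F i _ _ _) = i ∷ fan-inc F

    fan-last-fresh : ∀ {f e ds} → Fan f (e ∷ ds) → All (e ≢_) ds
    fan-last-fresh seed               = []
    fan-last-fresh (grow _ _ e∉ _ _) = e∉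

    fan-map : ∀ {f g ds} → Fan f ds → (∀ {e} → e ∈ ds → f e < t → g e ≡ f e) →
      (∀ {d e} → d ∈ ds → e ∈ ds → f e < t → Missing f (other x d) (f e) → Missing g (other x d) (f e)) →
      Fan g ds
    fan-map seed _ _ = seed
    fan-map {g = g} (grow F i e∉ l m) same miss =
      grow (fan-map F (same ∘ there) (λ p q → miss (there p) (there q))) i e∉
        (subst (_< t) (≡.sym g≡f) l)
        (subst (Missing g _) (≡.sym g≡f) (miss (there (here refl)) (here refl) l m))
      where g≡f = same (here refl) l

    -- Recolouring starts at the last edge of the fan, so that each step frees at x the colour the next one needs.
    rotate : ∀ {f} e ds {α} → Proper G (suc t) f → Fan f (e ∷ ds) → α < t →
      Missing f x α → Missing f (other x e) α → Removes e₀ f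
    rotate {f} _ [] {α} P seed α<t m m′ =
      recolour f e₀ α ,
      recolour-interchange P (ℕₚ.m<n⇒m<1+n α<t) (missing-ends x∈e₀ m m′) ◅ ε ,
      recolour-keeps {f} {e₀} α<t ,
      λ p → ℕₚ.<⇒≢ α<t (trans (≡.sym (recolour-at f e₀ α)) p)
    rotate {f} e (d ∷ ds) {α} P (grow F i e∉ l md) α<t m m′ =
      removes-◅ {f = f} {g} move (recolour-keeps {f} {e} α<t)
        (rotate d ds (interchange-proper {f = f} {g} P move)
          (fan-map F (λ q _ → recolour-≢ f α (All.lookup e∉ q ∘ ≡.sym)) (λ q _ _ → recolour-missing (far q)))
          l (recolour-frees P i m) (recolour-missing (far (here refl)) md))
      where
      g = recolour f e α
      move : Interchange G (suc t) f g
      move = recolour-interchange P (ℕₚ.m<n⇒m<1+n α<t) (missing-ends i m m′)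
      -- The far ends of the earlier fan edges do not lie on `e`, so recolouring `e` leaves their
      -- missing colours intact.
      far : ∀ {d′} → d′ ∈ d ∷ ds → ¬ Inc (other x d′) e
      far q j = All.lookup e∉ q (other-injective i k (≡.sym (inc-other i j (other-≢ k))))
        where k = All.lookup (fan-inc F) q

    module _ {f g : Coloring G} {α γ : ℕ} {e′ : Edge G} (P : Proper G (suc t) f) (f-e₀ : f e₀ ≡ t)
             (α<t : α < t) (γ<t : γ < t) (x-misses : Missing f x γ) (x∈e′ : Inc x e′) (f-e′ : f e′ ≡ α)
             (S : Swapped α γ e′ f g) where

      private
        i₀ : InAB α γ (f e′)
        i₀ = inj₁ f-e′

      -- As γ is missing at `x`, the edge `e′` is the only one there in the colours to be swapped;
      -- all other fan edges keep their colours.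
      other-colours : ∀ {e} → Inc x e → e ≢ e′ → ¬ InAB α γ (f e)
      other-colours i e≢e′ (inj₁ p) = e≢e′ (proper-injective P i x∈e′ (trans p (≡.sym f-e′)))
      other-colours i e≢e′ (inj₂ p) = x-misses _ i p

      swapped-fan : ∀ {ds} → Fan f ds → All (e′ ≢_) ds → Fan g ds
      swapped-fan F e′∉ = fan-map F
        (λ q _ → swapped-fixes {f = f} {g} i₀ S (∉AB q))
        (λ _ q _ → swapped-missing-≢ {f = f} {g} i₀ S (∉AB q))
        where
        ∉AB : ∀ {e} → e ∈ _ → ¬ InAB α γ (f e)
        ∉AB q = other-colours (All.lookup (fan-inc F) q) (All.lookup e′∉ q ∘ ≡.sym)

      -- The far end of the predecessor of e′ decides whether the fan up to it, or the whole fan, survives the swap.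
      split-fan : ∀ {e ds} → Fan f (e ∷ ds) → e′ ∈ e ∷ ds →
        (∃₂ λ d ds′ → Fan g (d ∷ ds′) × Missing f (other x d) α × ¬ Touched f α γ e′ (other x d)) ⊎
        (Fan g (e ∷ ds) × ∃[ d ] (d ∈ ds × Missing f (other x d) α × Touched f α γ e′ (other x d)))
      split-fan seed (here refl) = contradiction (trans (≡.sym f-e′) f-e₀) (ℕₚ.<⇒≢ α<t)
      split-fan (grow {d = d} {ds} F i e∉ l m) (here refl) with touched? f α γ e′ (other x d)
      ... | no ¬τ = inj₁ (d , ds , swapped-fan F e∉ , subst (Missing f _) f-e′ m , ¬τ)
      -- The swap turns both the colour of `e′` and the colour missing at the far end of `d` from α
      -- into γ, so `e′` still continues the fan.
      ... | yes τ = inj₂ (grow (swapped-fan F e∉) i e∉ (subst (_< t) (≡.sym g-e′) γ<t)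
                            (subst (Missing g _) (≡.sym g-e′)
                              (swapped-missing-touched {f = f} {g} i₀ S τ (inj₁ refl) (inj₁ (refl , refl)) m′)) ,
                          d , here refl , m′ , τ)
        where
        m′ = subst (Missing f _) f-e′ m
        g-e′ : g e′ ≡ γ
        g-e′ = swapCol-functional (proj₁ (S e′) ε) (inj₁ (f-e′ , refl))
      split-fan (grow F i e∉ l m) (there q) with split-fan F q
      ... | inj₁ r = inj₁ r
      ... | inj₂ (F′ , d , p , md , τ) =
        inj₂ (grow F′ i e∉ (subst (_< t) (≡.sym g≡f) l)
                (subst (Missing g _) (≡.sym g≡f) (swapped-missing-≢ {f = f} {g} i₀ S ∉AB m)) ,
              d , there p , md , τ)
        where
        ∉AB = other-colours i (All.lookup e∉ q)
        g≡f = swapped-fixes {f = f} {g} i₀ S ∉AB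

      swap-fan : ∀ {e ds} → Fan f (e ∷ ds) → e′ ∈ e ∷ ds → Missing f (other x e) α → Removes e₀ f
      swap-fan {e} {ds} F q m = removes-◅ {f = f} {g} move (swapped-keeps {f = f} {g} α<t γ<t i₀ S) (finish (split-fan F q))
        where
        move : Interchange G (suc t) f g
        move = α , γ , e′ , ℕₚ.m<n⇒m<1+n α<t , ℕₚ.m<n⇒m<1+n γ<t , i₀ , S
        P′ : Proper G (suc t) g
        P′ = interchange-proper {f = f} {g} P move
        x-misses′ : Missing g x α
        x-misses′ = swapped-missing-touched {f = f} {g} i₀ S (e′ , x∈e′ , ε) (inj₂ refl) (inj₂ (inj₁ (refl , refl))) x-misses
        finish : _ → Removes e₀ g
        finish (inj₁ (d , ds′ , F′ , md , ¬τ)) =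
          rotate d ds′ P′ F′ α<t x-misses′ (swapped-missing-untouched {f = f} {g} i₀ S ¬τ md)
        finish (inj₂ (F′ , d , p , md , τ)) =
          rotate e ds P′ F′ α<t x-misses′ (swapped-missing-untouched {f = f} {g} i₀ S ¬τ m)
          where
          k = All.lookup (fan-inc F) (here refl)
          k′ = All.lookup (fan-inc F) (there p)
          -- The far ends of `d` and `e` both miss α, and the chain has only one end besides `x`. It
          -- reaches that of `d`, so α stays missing at that of `e`.
          ¬τ : ¬ Touched f α γ e′ (other x e)
          ¬τ τ′ = All.lookup (fan-last-fresh F) p (other-injective k k′
            (chain-end-unique P x∈e′ f-e′ x-misses (other-≢ k) (other-≢ k′) m md τ′ τ))

    -- A colour α missing at the far end of the last edge is missing at `x` (rotate), borne by a fan
    -- edge (swap a chain), or borne by a new edge, which extends the fan. The list `rest` covers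
    -- the edges outside the fan; it shrinks with each extension, and `k` bounds the recursion.
    fan-removes : Δ G < t → ∀ {f} → Proper G (suc t) f → f e₀ ≡ t → ∀ k rest → length rest ≤ k → ∀ {e ds} → Fan f (e ∷ ds) →
      (∀ d → d ∉ e ∷ ds → d ∈ rest) → Removes e₀ f
    fan-removes Δ<t {f} P f-e₀ k rest len {e} {ds} F cover with missing-colour f (other x e) Δ<t
    ... | α , α<t , m with present? f x α
    ... | inj₂ m′ = rotate e ds P F α<t m′ m
    ... | inj₁ (e′ , i , refl) with Any.any? (e′ ≟ᵉ_) (e ∷ ds)
    ... | yes q = let (γ , γ<t , mγ) = missing-colour f x Δ<t ; (g , S) = swapped-exists (f e′) γ e′ f in
                  swap-fan {g = g} P f-e₀ α<t γ<t mγ i refl S F q m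
    ... | no ∉ with k | ℕₚ.<-≤-trans (filter-notAll (λ d → ¬? (d ≟ᵉ e′)) rest (lose (cover e′ ∉) λ p → p refl)) len
    ... | suc k′ | s≤s len′ =
      fan-removes Δ<t P f-e₀ k′ _ len′ (grow F i (¬Any⇒All¬ _ ∉) α<t m)
        λ d d∉ → ∈-filter⁺ (λ d → ¬? (d ≟ᵉ e′)) (cover d (d∉ ∘ there)) (d∉ ∘ here)

  remove-colour : Δ G < t → ∀ {f} → Proper G (suc t) f → ∀ e₀ → Removes e₀ f
  remove-colour Δ<t {f} P e₀ with f e₀ ℕ.≟ t
  ... | yes p = fan-removes {u e₀} {e₀} (inj₁ refl) Δ<t P p _ (edges G) ℕₚ.≤-refl seed (λ d _ → ∈-edges d)
  ... | no p  = f , ε , (λ _ → id) , p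

  remove-colours : Δ G < t → ∀ {f} → Proper G (suc t) f → ∀ es →
    ∃[ g ] (Star (Interchange G (suc t)) f g × (∀ e → g e ≡ t → f e ≡ t) × All (λ e → g e ≢ t) es)
  remove-colours Δ<t {f} P []       = f , ε , (λ _ → id) , []
  remove-colours Δ<t {f} P (e ∷ es) with remove-colours Δ<t P es
  ... | g , s , h , ps with remove-colour Δ<t (interchanges-proper P s) e
  ... | g′ , s′ , h′ , p = g′ , s ◅◅ s′ , (λ d → h d ∘ h′ d) , p ∷ All.map (_∘ h′ _) ps

  vizing : Δ G < t → ∀ {f} → Proper G (suc t) f → ∃[ g ] (Star (Interchange G (suc t)) f g × Proper G t g)
  vizing Δ<t P with remove-colours Δ<t P (edges G)
  ... | g , s , _ , ps = let (bound , proper) = interchanges-proper P s in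
    g , s , (λ e → ℕₚ.≤∧≢⇒< (ℕₚ.m<1+n⇒m≤n (bound e)) (All.lookup ps (∈-edges e))) , proper

-- Deleting a matching.

module _ {G : Graph} {M : Edge G → Set} (M? : Decidable₁ M) where

  -- Distinct vertices are related exactly when they are the two ends of an edge of `M`. A pair `x`,
  -- `x` may qualify too, but such a pair is never adjacent.
  Deleted : Fin (n G) → Fin (n G) → Set
  Deleted x y = ∃[ e ] M e × Inc x e × Inc y e

  deleted? : ∀ x y → Dec (Deleted x y)
  deleted? x y = anyEdge? (λ e → M? e ×-dec inc? x e ×-dec inc? y e)

  delete : Graph
  delete .n       = n G
  delete .adj x y = adj G x y ∧ not (isYes (deleted? x y))
  delete .sym x y = cong₂ _∧_ (sym G x y) (cong not (begin
    isYes (deleted? x y) ≡⟨ isYes≗does (deleted? x y) ⟩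
    does (deleted? x y)  ≡⟨ does-⇔ (mk⇔ swap-ends swap-ends) (deleted? x y) (deleted? y x) ⟩
    does (deleted? y x)  ≡⟨ isYes≗does (deleted? y x) ⟨
    isYes (deleted? y x) ∎))
    where
    open ≡.≡-Reasoning
    swap-ends : ∀ {x y} → Deleted x y → Deleted y x
    swap-ends (e , m , i , j) = e , m , j , i
  delete .irref x rewrite irref G x = refl

  degree-delete : ∀ x → degree delete x ≤ degree G x
  degree-delete x = go (allFin (n G))
    where
    go : ∀ ys → sum (map (λ y → if adj delete x y then 1 else 0) ys) ≤ sum (map (λ y → if adj G x y then 1 else 0) ys)
    go []       = z≤n
    go (y ∷ ys) with adj G x y | isYes (deleted? x y)
    ... | true  | true  = ℕₚ.m≤n⇒m≤1+n (go ys)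
    ... | true  | false = s≤s (go ys)
    ... | false | _     = go ys

  Δ-delete : Δ delete ≤ Δ G
  Δ-delete = Δ≤ delete λ x → ≤-trans (degree-delete x) (degree≤Δ G x)

  embed : Edge delete → Edge G
  embed e = edge (u e) (v e) (u<v e) (proj₁ (Equivalence.to T-∧ (isAdj e)))

  embed-∉ : ∀ e → ¬ M (embed e)
  embed-∉ e m = toWitnessFalse {a? = deleted? (u e) (v e)} (proj₂ (Equivalence.to T-∧ (isAdj e)))
    (embed e , m , inj₁ refl , inj₂ refl)

  restrict : ∀ e → ¬ M e → Edge delete
  restrict e e∉ = edge (u e) (v e) (u<v e) (Equivalence.from T-∧ (isAdj e , fromWitnessFalse kept))
    where
    kept : ¬ Deleted (u e) (v e)
    -- An edge of `M` through both ends of `e` is `e` itself.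
    kept (d , m , i , j) = e∉ (subst M (other-injective i (inj₁ refl)
      (trans (≡.sym (inc-other i j (u≢v e ∘ ≡.sym))) (inc-other {e = e} (inj₁ refl) (inj₂ refl) (u≢v e ∘ ≡.sym)))) m)

  extend : Coloring delete → ℕ → Coloring G
  extend h c e with M? e
  ... | yes _ = c
  ... | no e∉ = h (restrict e e∉)

  extend-∈ : ∀ h c {e} → M e → extend h c e ≡ c
  extend-∈ h c {e} m with M? e
  ... | yes _ = refl
  ... | no e∉ = contradiction m e∉

  extend-∉ : ∀ h c {e} (e∉ : ¬ M e) → extend h c e ≡ h (restrict e e∉)
  extend-∉ h c {e} e∉ with M? e
  ... | yes m = contradiction m e∉
  ... | no _  = cong h (edge-≡ refl refl)

  extend-embed : ∀ h c e → extend h c (embed e) ≡ h e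
  extend-embed h c e = trans (extend-∉ h c (embed-∉ e)) (cong h (edge-≡ refl refl))

  extend-≗ : ∀ {h k} c → h ≗ k → extend h c ≗ extend k c
  extend-≗ c h≗k e with M? e
  ... | yes _ = refl
  ... | no _  = h≗k _

  embedding : ∀ {e} → ¬ M e → ∃[ d ] embed d ≡ e
  embedding {e} e∉ = restrict e e∉ , edge-≡ refl refl

  restrict-proper : ∀ {s t f} → Proper G s f → (∀ e → ¬ M e → f e < t) → Proper delete t (f ∘ embed)
  restrict-proper (_ , q) bound = (λ e → bound (embed e) (embed-∉ e)) , λ e d → q (embed e) (embed d)

  -- Lifting interchanges from the smaller graph.

  module _ {t : ℕ} where

    extend-inAB : ∀ {a b} → a < t → b < t → ∀ h {e} → InAB a b (extend h t e) → ¬ M e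
    extend-inAB a<t b<t h (inj₁ p) m = ℕₚ.<⇒≢ a<t (trans (≡.sym p) (extend-∈ h t m))
    extend-inAB a<t b<t h (inj₂ p) m = ℕₚ.<⇒≢ b<t (trans (≡.sym p) (extend-∈ h t m))

    component-embed : ∀ {a b} h {e d} → Component h a b e d → Component (extend h t) a b (embed e) (embed d)
    component-embed {a} {b} h = Star.gmap embed λ {e} {d} (i , j , e~d) →
      subst (InAB a b) (≡.sym (extend-embed h t e)) i , subst (InAB a b) (≡.sym (extend-embed h t d)) j , e~d

    -- The edges of `M` have colour `t`, different from `a` and `b`, so a chain that starts outside
    -- `M` never enters it.
    component-embed⁻ : ∀ {a b} → a < t → b < t → ∀ h {e d} → Component (extend h t) a b (embed e) d →
      ∃[ d′ ] embed d′ ≡ d × Component h a b e d′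
    component-embed⁻ a<t b<t h ε = _ , refl , ε
    component-embed⁻ {a} {b} a<t b<t h {e} ((i , j , e~d) ◅ s) with embedding (extend-inAB a<t b<t h j)
    ... | d , refl with component-embed⁻ a<t b<t h s
    ... | d′ , p , s′ = d′ , p ,
      (subst (InAB a b) (extend-embed h t e) i , subst (InAB a b) (extend-embed h t d) j , e~d) ◅ s′

    extend-interchange : ∀ {h k} → Interchange delete t h k → Interchange G (suc t) (extend h t) (extend k t)
    extend-interchange {h} {k} (a , b , e₀ , a<t , b<t , i₀ , S) =
      a , b , embed e₀ , ℕₚ.m<n⇒m<1+n a<t , ℕₚ.m<n⇒m<1+n b<t ,
      subst (InAB a b) (≡.sym (extend-embed h t e₀)) i₀ , λ e → inside e , outside e
      where
      inside : ∀ e → Component (extend h t) a b (embed e₀) e → swapCol a b (extend h t e) (extend k t e)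
      inside e s with component-embed⁻ a<t b<t h s
      ... | d , refl , s′ = subst₂ (swapCol a b) (≡.sym (extend-embed h t d)) (≡.sym (extend-embed k t d)) (proj₁ (S d) s′)
      outside : ∀ e → ¬ Component (extend h t) a b (embed e₀) e → extend k t e ≡ extend h t e
      outside e ¬s with M? e
      ... | yes _ = refl
      ... | no e∉ = proj₂ (S _) λ s → ¬s (subst (Component (extend h t) a b (embed e₀)) (edge-≡ refl refl) (component-embed h s))

    extend-kempe : ∀ {h k} → KempeEquiv delete t h k → KempeEquiv G (suc t) (extend h t) (extend k t)
    extend-kempe (l , s , p) =
      extend l t , Star.gmap (λ h → extend h t) (λ {h} {k} → extend-interchange {h} {k}) s , extend-≗ t p

  -- Turning a matching into a colour class.

  module _ (matching : ∀ e d → M e → M d → ¬ Adjacent e d) {t : ℕ} where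

    extend-proper : ∀ {h} → Proper delete t h → Proper G (suc t) (extend h t)
    extend-proper {h} (p , q) = bound , proper
      where
      bound : ∀ e → extend h t e < suc t
      bound e with M? e
      ... | yes _ = ℕₚ.n<1+n t
      ... | no _  = ℕₚ.m<n⇒m<1+n (p _)
      proper : ∀ e d → Adjacent e d → extend h t e ≢ extend h t d
      proper e d e~d r with M? e | M? d
      ... | yes m | yes m′ = matching e d m m′ e~d
      ... | yes _ | no _   = ℕₚ.<⇒≢ (p _) (≡.sym r)
      ... | no _  | yes _  = ℕₚ.<⇒≢ (p _) r
      ... | no _  | no _   = q _ _ e~d r

    -- Colour t is unused by f, so the edges of M can take it one at a time.
    recolour-matching : ∀ {f} → Proper G t f → ∀ es →
      ∃[ g ] (Star (Interchange G (suc t)) f g × (∀ e → M e × g e ≡ t ⊎ g e ≡ f e) × All (λ e → M e → g e ≡ t) es)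
    recolour-matching {f} P [] = f , ε , (λ _ → inj₂ refl) , []
    recolour-matching {f} P (e ∷ es) with recolour-matching P es
    ... | g , s , h , ps with M? e | g e ℕ.≟ t
    ... | no e∉ | _     = g , s , h , (λ m → contradiction m e∉) ∷ ps
    ... | yes _ | yes p = g , s , h , (λ _ → p) ∷ ps
    ... | yes m | no ¬p =
      recolour g e t ,
      s ◅◅ (recolour-interchange (interchanges-proper (proper-mono (ℕₚ.n≤1+n t) P) s) (ℕₚ.n<1+n t) free ◅ ε) ,
      h′ , (λ _ → recolour-at g e t) ∷ All.map keep ps
      where
      -- As `f` uses only colours below `t`, an edge of colour `t` lies in `M`; sharing a vertex
      -- with `e`, it would have to be `e`, which does not have colour `t` yet.
      free : ∀ x → Inc x e → Missing g x t
      free x i d j p with h d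
      ... | inj₂ q = ℕₚ.<⇒≢ (proj₁ P d) (trans (≡.sym q) p)
      ... | inj₁ (m′ , _) = matching e d m m′ (adjacent {e = e} {d} (λ { refl → ¬p p }) i j)
      h′ : ∀ d → M d × recolour g e t d ≡ t ⊎ recolour g e t d ≡ f d
      h′ d with d ≟ᵉ e
      ... | yes refl = inj₁ (m , refl)
      ... | no _     = h d
      keep : ∀ {d} → (M d → g d ≡ t) → M d → recolour g e t d ≡ t
      keep {d} k m′ with d ≟ᵉ e
      ... | yes _ = refl
      ... | no _  = k m′

    matching-kempe : ∀ {f} → Proper G t f → KempeEquiv G (suc t) f (extend (f ∘ embed) t)
    matching-kempe {f} P with recolour-matching P (edges G)
    ... | g , s , h , ps = g , s , agree
      where
      agree : g ≗ extend (f ∘ embed) t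
      agree e with M? e | h e
      ... | yes m | _             = All.lookup ps (∈-edges e) m
      ... | no e∉ | inj₁ (m , _)  = contradiction m e∉
      ... | no _  | inj₂ p        = trans p (cong f (edge-≡ refl refl))

-- From the Vizing property to Kempe equivalence.

module _ {k : ℕ} (vizing-property : ∀ G → MaxDegAtMost G k → Class1 G → VizingProperty G) where

  -- If Δ lies below the chromatic index, the fan argument suffices; otherwise `G` is Class 1 and
  -- the hypothesis applies with Δ + 1 colours.
  to-optimal : ∀ G → MaxDegAtMost G k → ∀ c → IsChromaticIndex G c → ∀ {f} → Proper G (suc c) f →
    ∃[ g ] (Star (Interchange G (suc c)) f g × Proper G c g)
  to-optimal G Δ≤k c (C , least) {f} P with ℕₚ.m≤n⇒m<n∨m≡n (Colorable⇒Δ≤ C)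
  ... | inj₁ Δ<c  = vizing Δ<c P
  ... | inj₂ refl = vizing-property G Δ≤k (C , least) (suc (Δ G)) ℕₚ.≤-refl f P

  all-equivalent : ∀ c G → MaxDegAtMost G k → IsChromaticIndex G c →
    ∀ f g → Proper G (suc c) f → Proper G (suc c) g → KempeEquiv G (suc c) f g
  -- Chromatic index 0 means that there are no edges.
  all-equivalent zero G _ ((_ , bound , _) , _) f g _ _ = f , ε , λ e → contradiction (bound e) λ ()
  all-equivalent (suc c) G Δ≤k χ f g Pf Pg with to-optimal G Δ≤k (suc c) χ Pf | to-optimal G Δ≤k (suc c) χ Pg
  ... | f′ , sf , Pf′ | g′ , sg , Pg′ =
    kempe-trans (kempe-star sf) (kempe-trans f′~g′ (kempe-sym (kempe-star sg)))
    where
    M? : ∀ e → Dec (g′ e ≡ c)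
    M? e = g′ e ℕ.≟ c

    matching : ∀ e d → g′ e ≡ c → g′ d ≡ c → ¬ Adjacent e d
    matching e d p q e~d = proj₂ Pg′ e d e~d (trans p (≡.sym q))

    H : Graph
    H = delete M?

    g′-proper : Proper H c (g′ ∘ embed M?)
    g′-proper = restrict-proper M? Pg′ λ e e∉ → ℕₚ.≤∧≢⇒< (ℕₚ.m<1+n⇒m≤n (proj₁ Pg′ e)) e∉

    -- Giving the edges of `M` a new colour extends a `j`-colouring of `H` to a `(j+1)`-colouring of
    -- `G`, so `j` is at least `c`.
    H-index : IsChromaticIndex H c
    H-index = (_ , g′-proper) , λ j (h , Ph) → ℕ.s≤s⁻¹ (proj₂ χ (suc j) (_ , extend-proper M? matching Ph))

    f′~g′ : KempeEquiv G (suc (suc c)) f′ g′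
    -- In both colourings `M` takes the spare colour `suc c`. On `H`, the restriction of `f′` may
    -- still use all `suc c` colours, one more than the index of `H`, which is what the induction
    -- hypothesis allows.
    f′~g′ = kempe-trans (matching-kempe M? matching Pf′) (kempe-trans
      (extend-kempe M? (all-equivalent c H (≤-trans (Δ-delete M?) Δ≤k) H-index _ _
        (restrict-proper M? Pf′ λ e _ → proj₁ Pf′ e) (proper-mono (ℕₚ.n≤1+n c) g′-proper)))
      (kempe-sym (matching-kempe M? matching Pg′)))

-- From Kempe equivalence to the Vizing property.

-- The fan argument works as long as more than Δ colours remain after a removal, so the `d` surplus
-- colours go one by one.
to-Δ+1 : ∀ {G} d {f} → Proper G (d + suc (Δ G)) f →
  ∃[ g ] (Star (Interchange G (d + suc (Δ G))) f g × Proper G (suc (Δ G)) g)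
to-Δ+1 zero P = _ , ε , P
to-Δ+1 {G} (suc d) P with vizing (ℕₚ.m≤n+m (suc (Δ G)) d) P
... | g , s , Q with to-Δ+1 d Q
... | h , s′ , R = h , s ◅◅ Star.map (λ {f} {g} → interchange-mono {f = f} {g} (ℕₚ.n≤1+n _)) s′ , R

equivalence⇒vizing-property : ∀ {G} → Class1 G →
  (∀ f g → Proper G (suc (Δ G)) f → Proper G (suc (Δ G)) g → KempeEquiv G (suc (Δ G)) f g) → VizingProperty G
equivalence⇒vizing-property {G} ((f₀ , P₀) , _) equivalent t Δ<t f P
  with to-Δ+1 (t ℕ.∸ suc (Δ G)) (subst (λ t → Proper G t f) (≡.sym (ℕₚ.m∸n+n≡m Δ<t)) P)
-- The Class 1 hypothesis supplies the Δ-colouring `f₀`, here regarded as a colouring with Δ + 1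
-- colours.
... | g , s , Q with equivalent g f₀ Q (proper-mono (ℕₚ.n≤1+n _) P₀)
... | h , s′ , h≗f₀ =
  h , subst (λ t → Star (Interchange G t) f g) (ℕₚ.m∸n+n≡m Δ<t) s ◅◅
        Star.map (λ {f} {g} → interchange-mono {f = f} {g} Δ<t) s′ ,
  proper-≗ (≡.sym ∘ h≗f₀) P₀

theorem1p1 : (k : ℕ) → 2 ≤ k →
    ((∀ G → MaxDegAtMost G k → Class1 G → VizingProperty G) →
    (∀ G → MaxDegAtMost G k → ∀ c → IsChromaticIndex G c →
    ∀ f g → Proper G (suc c) f → Proper G (suc c) g → KempeEquiv G (suc c) f g))
    ×
    ((∀ G → MaxDegAtMost G k → ∀ c → IsChromaticIndex G c →
    ∀ f g → Proper G (suc c) f → Proper G (suc c) g → KempeEquiv G (suc c) f g) →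
    (∀ G → MaxDegAtMost G k → Class1 G → VizingProperty G))
theorem1p1 k _ =
  (λ vizing-property G Δ≤k c → all-equivalent vizing-property c G Δ≤k) ,
  (λ equivalent G Δ≤k class1 → equivalence⇒vizing-property class1 (equivalent G Δ≤k (Δ G) class1))
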